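{- For every $\varepsilon>0$ there is a bipartite graph $G$ such that the expected size of the matching returned by EDSM on $G$ is less than $(\tfrac12+\varepsilon)\,\nu(G)$, and the expected size of the matching returned by MDS on $G$ is less than $(\tfrac12+\varepsilon)\,\nu(G)$.
   Context: For a finite simple graph $G$, $\nu(G)$ denotes the size of a maximum matching. Both algorithms maintain a current graph (initially $G$) and a matching $M$ (initially empty); after an edge $\{u,v\}$ is added to $M$, the nodes $u,v$ and all their incident edges are deleted from the current graph; they stop when the current graph has no edges; all degrees are degrees in the current graph. EDSM (enhanced Degree-Sequenced Matching): choose a node $u$ of minimum degree among the non-isolated nodes of the current graph, and match it to a neighbor of $u$ that has minimum degree among all neighbors of $u$; all ties are broken uniformly at random. MDS (Minimum Degree Sum): choose an edge $\{u,v\}$ of the current graph minimizing $d(u)+d(v)$, ties broken uniformly at random, and add it to $M$. -}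

module Defs where

open import Data.Bool using (Bool; true; false; _∧_; not; T)
open import Data.Nat as ℕ using (ℕ; zero; suc; _⊓_; _≡ᵇ_; _<ᵇ_)
open import Data.Fin using (Fin; toℕ)
import Data.Fin as F
open import Data.Integer using (+_)
open import Data.List using (List; []; _∷_; length; map; foldr; filterᵇ; allFin; cartesianProduct; concatMap)
open import Data.List.Relation.Unary.All using (All)
open import Data.List.Relation.Unary.Unique.Propositional using (Unique)
open import Data.Product using (_×_; _,_; proj₁; proj₂; ∃; ∃-syntax)
open import Data.Rational using (ℚ; 0ℚ; 1ℚ; _+_; _*_; _/_)
open import Relation.Binary.PropositionalEquality using (_≡_; _≢_)
open import Relation.Nullary.Decidable using (⌊_⌋)

record Graph (n : ℕ) : Set where
  field
    adj    : Fin n → Fin n → Bool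
    sym    : ∀ u v → adj u v ≡ adj v u
    irrefl : ∀ u → adj u u ≡ false
open Graph public

Bipartite : ∀ {n} → Graph n → Set
Bipartite {n} G = ∃ λ (col : Fin n → Bool) → (∀ (u v : Fin n) → T (adj G u v) → col u ≢ col v)

endpoints : ∀ {n} → List (Fin n × Fin n) → List (Fin n)
endpoints = concatMap (λ e → proj₁ e ∷ proj₂ e ∷ [])

IsMatching : ∀ {n} → Graph n → List (Fin n × Fin n) → Set
IsMatching G M = All (λ e → T (adj G (proj₁ e) (proj₂ e))) M × Unique (endpoints M)

IsMatchingNumber : ∀ {n} → Graph n → ℕ → Set
IsMatchingNumber G m =
  (∃[ M ] (IsMatching G M × length M ≡ m)) ×
  (∀ M → IsMatching G M → length M ℕ.≤ m)

-- The current graph: G restricted to the alive vertices.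

Alive : ℕ → Set
Alive n = Fin n → Bool

allAlive : ∀ {n} → Alive n
allAlive _ = true

remove : ∀ {n} → Alive n → Fin n → Fin n → Alive n
remove a u v w = a w ∧ not ⌊ w F.≟ u ⌋ ∧ not ⌊ w F.≟ v ⌋

edgeIn : ∀ {n} → Graph n → Alive n → Fin n → Fin n → Bool
edgeIn G a u v = a u ∧ a v ∧ adj G u v

nbrs : ∀ {n} → Graph n → Alive n → Fin n → List (Fin n)
nbrs {n} G a u = filterᵇ (edgeIn G a u) (allFin n)

deg : ∀ {n} → Graph n → Alive n → Fin n → ℕ
deg G a u = length (nbrs G a u)

nonIsolated : ∀ {n} → Graph n → Alive n → List (Fin n)
nonIsolated {n} G a = filterᵇ (λ u → a u ∧ (0 <ᵇ deg G a u)) (allFin n)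

edges : ∀ {n} → Graph n → Alive n → List (Fin n × Fin n)
edges {n} G a = filterᵇ (λ e → ⌊ proj₁ e F.<? proj₂ e ⌋ ∧ edgeIn G a (proj₁ e) (proj₂ e))
                        (cartesianProduct (allFin n) (allFin n))

minVal : ∀ {A : Set} → (A → ℕ) → List A → ℕ
minVal f []       = 0
minVal f (x ∷ xs) = foldr (λ y acc → f y ⊓ acc) (f x) xs

argmins : ∀ {A : Set} → (A → ℕ) → List A → List A
argmins f xs = filterᵇ (λ x → f x ≡ᵇ minVal f xs) xs

mean : List ℚ → ℚ
mean []         = 0ℚ
mean xs@(_ ∷ ys) = foldr _+_ 0ℚ xs * (+ 1 / suc (length ys))

-- Expected matching sizes (ties broken uniformly at random).
-- The first argument is fuel; every step deletes two alive vertices,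
-- so fuel n (the number of vertices) is never exhausted before the
-- current graph becomes edgeless.  When no edge remains the expected
-- number of further matched edges is 0.

expEDSM : ∀ {n} → ℕ → Graph n → Alive n → ℚ
expEDSM zero    G a = 0ℚ
expEDSM (suc k) G a =
  mean (map (λ u → mean (map (λ v → 1ℚ + expEDSM k G (remove a u v))
                             (argmins (deg G a) (nbrs G a u))))
            (argmins (deg G a) (nonIsolated G a)))

expMDS : ∀ {n} → ℕ → Graph n → Alive n → ℚ
expMDS zero    G a = 0ℚ
expMDS (suc k) G a =
  mean (map (λ e → 1ℚ + expMDS k G (remove a (proj₁ e) (proj₂ e)))
            (argmins (λ e → deg G a (proj₁ e) ℕ.+ deg G a (proj₂ e)) (edges G a)))

E-EDSM : ∀ {n} → Graph n → ℚ
E-EDSM {n} G = expEDSM n G allAlive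

E-MDS : ∀ {n} → Graph n → ℚ
E-MDS {n} G = expMDS n G allAlive

{-# OPTIONS --safe #-}
module Submission where

-- Both algorithms prefer the inner edge of every path A₀ – B₀ – B₁ – A₁ in a graph in which the
-- outer vertices A of all paths are joined to a few hub vertices: then each B has degree 2, while each
-- A and each hub has degree at least 5, and choosing the inner edges does not change the latter.
-- When they are exhausted every remaining edge contains one of the 10 hubs, so that n paths
-- yield a matching of size at most n + 10, whereas the graph has a perfect matching of
-- size 2n + 5. Every run satisfies the bound, hence so does the mean.

open import Defs hiding (sym)
open import Data.Nat using (ℕ)
open import Data.Product using (Σ; ∃; _×_)
open import Data.Rational using (ℚ; 0ℚ; ½; _+_; _*_; _<_; _/_)
open import Data.Integer using (+_)

open import Data.Bool using (Bool; true; false; _∧_; not; T)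
import Data.Bool.Properties as Bool
open import Data.Bool.Properties using (T-∧; T?; ¬-not; not-¬; not-injective)
open import Data.Empty using (⊥-elim)
open import Data.Fin using (Fin)
import Data.Fin as Fin
import Data.Fin.Properties as Fin
import Data.Integer as ℤ
import Data.Integer.Properties as ℤ
open import Data.List using (List; []; _∷_; _++_; length; map; foldr; filterᵇ; allFin; cartesianProduct)
open import Data.List.Properties using (length-map; length-++; length-tabulate; filter-notAll)
open import Data.List.Membership.Propositional using (_∈_; lose)
open import Data.List.Membership.Propositional.Properties
  using (∈-filter⁺; ∈-filter⁻; ∈-allFin; ∈-cartesianProduct⁺; ∈-map⁺; ∈-map⁻; ∈-++⁺ˡ; ∈-++⁺ʳ)
open import Data.List.Relation.Binary.Subset.Propositional using (_⊆_)
open import Data.List.Relation.Unary.All as All using (All; []; _∷_)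
open import Data.List.Relation.Unary.AllPairs using ([]; _∷_)
open import Data.List.Relation.Unary.Any using (here; there)
open import Data.List.Relation.Unary.Unique.Propositional using (Unique)
import Data.List.Relation.Unary.Unique.Propositional.Properties as Unique
open import Data.Nat using (suc; _⊓_)
import Data.Nat as ℕ
open import Data.Nat.Coprimality using (Coprime)
import Data.Nat.Properties as ℕ
open import Data.Nat.Tactic.RingSolver using (solve-∀)
open import Data.Product using (_,_; proj₁; proj₂)
open import Data.Product.Function.NonDependent.Propositional using (_×-↔_)
open import Data.Rational using (1ℚ; _≤_; mkℚ; toℚᵘ; positive)
import Data.Rational.Properties as ℚ
import Data.Rational.Unnormalised as ℚᵘ
import Data.Rational.Unnormalised.Properties as ℚᵘ
open import Data.Sum using (_⊎_; inj₁; inj₂; [_,_])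
open import Data.Sum.Function.Propositional using (_⊎-↔_)
open import Function using (_∘_; _↔_; Inverse; Equivalence)
open import Function.Properties.Inverse using (↔-refl; ↔-trans)
open import Relation.Binary.PropositionalEquality
  using (_≡_; _≢_; refl; sym; trans; cong; subst; subst₂; ≢-sym)
open import Relation.Binary using (tri<; tri≈; tri>)
open import Relation.Nullary using (¬_; Dec; yes; no; contradiction)
open import Relation.Nullary.Decidable using (⌊_⌋; map′; toWitness; fromWitness; ¬?; _×-dec_)

-- Naturals as rationals, and bounds on means.

toℚᵘ-/1 : ∀ n → toℚᵘ (+ n / 1) ℚᵘ.≃ ℚᵘ.mkℚᵘ (+ n) 0
toℚᵘ-/1 n = ℚ.toℚᵘ-fromℚᵘ (ℚᵘ.mkℚᵘ (+ n) 0)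

suc-/1 : ∀ n → + suc n / 1 ≡ 1ℚ + + n / 1
suc-/1 n = ℚ.toℚᵘ-injective (begin-equality
  toℚᵘ (+ suc n / 1)                 ≃⟨ toℚᵘ-/1 (suc n) ⟩
  ℚᵘ.mkℚᵘ (+ suc n) 0                ≃⟨ ℚᵘ.*≡* (cong (ℤ._* (+ 1)) (cong (ℤ._+_ (+ 1)) (sym (ℤ.*-identityʳ (+ n))))) ⟩
  ℚᵘ.1ℚᵘ ℚᵘ.+ ℚᵘ.mkℚᵘ (+ n) 0        ≃⟨ ℚᵘ.+-congʳ ℚᵘ.1ℚᵘ (toℚᵘ-/1 n) ⟨
  toℚᵘ 1ℚ ℚᵘ.+ toℚᵘ (+ n / 1)        ≃⟨ ℚ.toℚᵘ-homo-+ 1ℚ (+ n / 1) ⟨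
  toℚᵘ (1ℚ + + n / 1)                ∎)
  where open ℚᵘ.≤-Reasoning

/1-*-1/ : ∀ n → (+ suc n / 1) * (+ 1 / suc n) ≡ 1ℚ
/1-*-1/ n = ℚ.toℚᵘ-injective (begin-equality
  toℚᵘ ((+ suc n / 1) * (+ 1 / suc n))           ≃⟨ ℚ.toℚᵘ-homo-* (+ suc n / 1) (+ 1 / suc n) ⟩
  toℚᵘ (+ suc n / 1) ℚᵘ.* toℚᵘ (+ 1 / suc n)     ≃⟨ ℚᵘ.*-cong (toℚᵘ-/1 (suc n)) (ℚ.toℚᵘ-fromℚᵘ (ℚᵘ.mkℚᵘ (+ 1) n)) ⟩
  ℚᵘ.mkℚᵘ (+ suc n) 0 ℚᵘ.* ℚᵘ.mkℚᵘ (+ 1) n       ≃⟨ ℚᵘ.*-inverseʳ (ℚᵘ.mkℚᵘ (+ suc n) 0) ⟩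
  toℚᵘ 1ℚ                                        ∎)
  where open ℚᵘ.≤-Reasoning

/1-mono-≤ : ∀ {m n} → m ℕ.≤ n → + m / 1 ≤ + n / 1
/1-mono-≤ {m} {n} m≤n = ℚ.toℚᵘ-cancel-≤ (begin
  toℚᵘ (+ m / 1)      ≃⟨ toℚᵘ-/1 m ⟩
  ℚᵘ.mkℚᵘ (+ m) 0     ≤⟨ ℚᵘ.*≤* (ℤ.*-monoʳ-≤-nonNeg (+ 1) (ℤ.+≤+ m≤n)) ⟩
  ℚᵘ.mkℚᵘ (+ n) 0     ≃⟨ toℚᵘ-/1 n ⟨
  toℚᵘ (+ n / 1)      ∎)
  where open ℚᵘ.≤-Reasoning

0≤/1 : ∀ n → 0ℚ ≤ + n / 1
0≤/1 n = /1-mono-≤ {0} {n} ℕ.z≤n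

module _ {A : Set} (f : A → ℚ) {q : ℚ} where

  foldr-+-≤ : ∀ xs → (∀ {x} → x ∈ xs → f x ≤ q) → foldr _+_ 0ℚ (map f xs) ≤ (+ length xs / 1) * q
  foldr-+-≤ [] _ = ℚ.≤-reflexive (sym (ℚ.*-zeroˡ q))
  foldr-+-≤ (x ∷ xs) f≤q = begin
    f x + foldr _+_ 0ℚ (map f xs)        ≤⟨ ℚ.+-mono-≤ (f≤q (here refl)) (foldr-+-≤ xs (f≤q ∘ there)) ⟩
    q + (+ length xs / 1) * q            ≡⟨ cong (_+ (+ length xs / 1) * q) (ℚ.*-identityˡ q) ⟨
    1ℚ * q + (+ length xs / 1) * q       ≡⟨ ℚ.*-distribʳ-+ q 1ℚ (+ length xs / 1) ⟨
    (1ℚ + + length xs / 1) * q           ≡⟨ cong (_* q) (suc-/1 (length xs)) ⟨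
    (+ suc (length xs) / 1) * q          ∎
    where open ℚ.≤-Reasoning

  mean-≤ : 0ℚ ≤ q → ∀ xs → (∀ {x} → x ∈ xs → f x ≤ q) → mean (map f xs) ≤ q
  -- The mean of an empty list is 0 by convention; only here is `0ℚ ≤ q` needed.
  mean-≤ 0≤q [] _ = 0≤q
  mean-≤ 0≤q xs@(x ∷ ys) f≤q rewrite length-map f ys = begin
    foldr _+_ 0ℚ (map f xs) * r       ≤⟨ ℚ.*-monoʳ-≤-nonNeg r {{ℚ.normalize-nonNeg 1 (suc (length ys))}} (foldr-+-≤ xs f≤q) ⟩
    (+ suc (length ys) / 1) * q * r   ≡⟨ cong (_* r) (ℚ.*-comm (+ suc (length ys) / 1) q) ⟩
    q * (+ suc (length ys) / 1) * r   ≡⟨ ℚ.*-assoc q _ r ⟩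
    q * ((+ suc (length ys) / 1) * r) ≡⟨ cong (q *_) (/1-*-1/ (length ys)) ⟩
    q * 1ℚ                            ≡⟨ ℚ.*-identityʳ q ⟩
    q                                 ∎
    where
    open ℚ.≤-Reasoning
    r = + 1 / suc (length ys)

-- Minimizers and counting in finite lists.

module _ {A : Set} (f : A → ℕ) where

  minVal-≤ : ∀ {x} xs → x ∈ xs → minVal f xs ℕ.≤ f x
  minVal-≤ (x ∷ xs) = go xs
    where
    go : ∀ {z} ys → z ∈ x ∷ ys → foldr (λ y acc → f y ⊓ acc) (f x) ys ℕ.≤ f z
    -- The fold starts from `f x`, so the bound for the head `x` descends through every `⊓` to the
    -- base, while the others are met on the way.
    go []       (here refl)         = ℕ.≤-refl
    go (y ∷ ys) (here refl)         = ℕ.≤-trans (ℕ.m⊓n≤n (f y) _) (go ys (here refl))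
    go (y ∷ ys) (there (here refl)) = ℕ.m⊓n≤m (f y) _
    go (y ∷ ys) (there (there z∈))  = ℕ.≤-trans (ℕ.m⊓n≤n (f y) _) (go ys (there z∈))

  ∈-argmins⁻ : ∀ {x} xs → x ∈ argmins f xs → x ∈ xs × (∀ {y} → y ∈ xs → f x ℕ.≤ f y)
  ∈-argmins⁻ xs x∈ with x∈xs , eq ← ∈-filter⁻ (λ x → T? (f x ℕ.≡ᵇ minVal f xs)) x∈ =
    x∈xs , λ y∈ → ℕ.≤-trans (ℕ.≤-reflexive (ℕ.≡ᵇ⇒≡ (f _) (minVal f xs) eq)) (minVal-≤ xs y∈)

-- Pigeonhole by induction on `xs`: filtering the head out of `ys` shortens `ys` strictly and keeps
-- the tail of `xs` inside, since the head does not recur.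
unique-⊆⇒length-≤ : ∀ {n} {xs ys : List (Fin n)} → Unique xs → xs ⊆ ys → length xs ℕ.≤ length ys
unique-⊆⇒length-≤ [] _ = ℕ.z≤n
unique-⊆⇒length-≤ {ys = ys} (_∷_ {x} x≢xs xs!) xs⊆ys = ℕ.≤-<-trans
  (unique-⊆⇒length-≤ xs! λ z∈ → ∈-filter⁺ ≢x? (xs⊆ys (there z∈)) (≢-sym (All.lookup x≢xs z∈)))
  (filter-notAll ≢x? ys (lose (xs⊆ys (here refl)) (λ x≢x → x≢x refl)))
  where ≢x? = λ y → ¬? (y Fin.≟ x)

length-allFin : ∀ n → length (allFin n) ≡ n
length-allFin n = length-tabulate {n = n} _

∈-filterᵇ⁺ : ∀ {n} (p : Fin n → Bool) {x} → T (p x) → x ∈ filterᵇ p (allFin n)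
∈-filterᵇ⁺ p {x} px = ∈-filter⁺ (T? ∘ p) (∈-allFin x) px

∈-filterᵇ⁻ : ∀ {n} (p : Fin n → Bool) {x} → x ∈ filterᵇ p (allFin n) → T (p x)
∈-filterᵇ⁻ p x∈ = proj₂ (∈-filter⁻ (T? ∘ p) {xs = allFin _} x∈)

filterᵇ-unique : ∀ {n} (p : Fin n → Bool) → Unique (filterᵇ p (allFin n))
filterᵇ-unique p = Unique.filter⁺ (T? ∘ p) (Unique.allFin⁺ _)

T-∧⁺ : ∀ {x y} → T x → T y → T (x ∧ y)
T-∧⁺ x y = Equivalence.from T-∧ (x , y)

T-∧⁻ : ∀ {x y} → T (x ∧ y) → T x × T y
T-∧⁻ = Equivalence.to T-∧

-- Deleting the endpoints of a chosen edge.

module _ {n} (a : Alive n) (u v : Fin n) where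

  remove⁺ : ∀ {w} → T (a w) → w ≢ u → w ≢ v → T (remove a u v w)
  remove⁺ {w} aw w≢u w≢v with w Fin.≟ u | w Fin.≟ v
  ... | yes w≡u | _       = contradiction w≡u w≢u
  ... | no _    | yes w≡v = contradiction w≡v w≢v
  ... | no _    | no _    = T-∧⁺ aw _

  remove⁻ : ∀ {w} → T (remove a u v w) → T (a w) × w ≢ u × w ≢ v
  remove⁻ {w} rw with w Fin.≟ u | w Fin.≟ v
  ... | yes _  | _      = ⊥-elim (proj₂ (T-∧⁻ {a w} rw))
  ... | no _   | yes _  = ⊥-elim (proj₂ (T-∧⁻ {a w} rw))
  ... | no w≢u | no w≢v = proj₁ (T-∧⁻ rw) , w≢u , w≢v

aliveIn : ∀ {n} → (Fin n → Bool) → Alive n → ℕ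
aliveIn {n} S a = length (filterᵇ (λ w → a w ∧ S w) (allFin n))

-- The survivors in `S` together with the deleted vertex `w` are distinct and were all counted
-- before, so one deleted endpoint in `S` already forces a strict decrease.
aliveIn-remove : ∀ {n} (S : Fin n → Bool) (a : Alive n) u v w → w ≡ u ⊎ w ≡ v → T (a w) → T (S w) →
  aliveIn S (remove a u v) ℕ.< aliveIn S a
aliveIn-remove S a u v w w≡ aw Sw = unique-⊆⇒length-≤ {xs = w ∷ _}
  (All.tabulate (λ { z∈ refl → w∉ (proj₁ (T-∧⁻ {remove a u v w} (∈-filterᵇ⁻ _ z∈))) }) ∷ filterᵇ-unique _)
  λ { (here refl) → ∈-filterᵇ⁺ _ (T-∧⁺ aw Sw)
    ; (there z∈)  → let rz , Sz = T-∧⁻ (∈-filterᵇ⁻ _ z∈)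
                    in ∈-filterᵇ⁺ _ (T-∧⁺ (proj₁ (remove⁻ a u v rz)) Sz) }
  where
  w∉ : ¬ T (remove a u v w)
  w∉ rw = let _ , w≢u , w≢v = remove⁻ a u v rw in [ w≢u , w≢v ] w≡

-- Degrees and edges of the current graph.

module _ {n} (G : Graph n) where

  edgeIn⁺ : ∀ a {u v} → T (a u) → T (a v) → T (adj G u v) → T (edgeIn G a u v)
  edgeIn⁺ a au av uv = T-∧⁺ au (T-∧⁺ av uv)

  edgeIn⁻ : ∀ a {u v} → T (edgeIn G a u v) → T (a u) × T (a v) × T (adj G u v)
  edgeIn⁻ a {u} {v} e with au , e′ ← T-∧⁻ {a u} e = au , T-∧⁻ e′

  edgeIn-sym : ∀ a {u v} → T (edgeIn G a u v) → T (edgeIn G a v u)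
  edgeIn-sym a {u} {v} e with au , av , uv ← edgeIn⁻ a e = edgeIn⁺ a av au (subst T (Graph.sym G u v) uv)

  deg-≤ : ∀ a {u} ys → (∀ {v} → T (edgeIn G a u v) → v ∈ ys) → deg G a u ℕ.≤ length ys
  deg-≤ a {u} ys h = unique-⊆⇒length-≤ (filterᵇ-unique (edgeIn G a u)) (h ∘ ∈-filterᵇ⁻ (edgeIn G a u))

  deg-≥ : ∀ a {u} ys → Unique ys → (∀ {v} → v ∈ ys → T (edgeIn G a u v)) → length ys ℕ.≤ deg G a u
  deg-≥ a {u} ys ys! h = unique-⊆⇒length-≤ ys! (∈-filterᵇ⁺ (edgeIn G a u) ∘ h)

  deg-pos : ∀ a {u v} → T (edgeIn G a u v) → 0 ℕ.< deg G a u
  deg-pos a {u} {v} e = deg-≥ a (v ∷ []) ([] ∷ []) λ { (here refl) → e }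

  ∈-nonIsolated : ∀ a {u v} → T (edgeIn G a u v) → u ∈ nonIsolated G a
  ∈-nonIsolated a e = ∈-filterᵇ⁺ _ (T-∧⁺ (proj₁ (edgeIn⁻ a e)) (ℕ.<⇒<ᵇ (deg-pos a e)))

  orientedEdge : Alive n → Fin n × Fin n → Bool
  orientedEdge a e = ⌊ proj₁ e Fin.<? proj₂ e ⌋ ∧ edgeIn G a (proj₁ e) (proj₂ e)

  ∈-edges⁻ : ∀ a {u v} → (u , v) ∈ edges G a → T (edgeIn G a u v)
  ∈-edges⁻ a {u} {v} e∈ with _ , e ← ∈-filter⁻ (T? ∘ orientedEdge a) {xs = cartesianProduct (allFin n) (allFin n)} e∈ = proj₂ (T-∧⁻ {⌊ u Fin.<? v ⌋} e)

  -- `edges` lists each edge once, smaller endpoint first, so the orientation depends on how `u` and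
  -- `v` compare.
  ∈-edges⁺ : ∀ a {u v} → T (edgeIn G a u v) → (u , v) ∈ edges G a ⊎ (v , u) ∈ edges G a
  ∈-edges⁺ a {u} {v} e with Fin.<-cmp u v
  ... | tri< u<v _ _ = inj₁ (∈-filter⁺ (T? ∘ orientedEdge a) (∈-cartesianProduct⁺ (∈-allFin u) (∈-allFin v))
                               (T-∧⁺ (fromWitness {a? = u Fin.<? v} u<v) e))
  ... | tri> _ _ v<u = inj₂ (∈-filter⁺ (T? ∘ orientedEdge a) (∈-cartesianProduct⁺ (∈-allFin v) (∈-allFin u))
                               (T-∧⁺ (fromWitness {a? = v Fin.<? u} v<u) (edgeIn-sym a e)))
  ... | tri≈ _ refl _ = ⊥-elim (subst T (irrefl G u) (proj₂ (proj₂ (edgeIn⁻ a e))))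

  -- Bounding the expected sizes by a potential.

  module _ (Inv : Alive n → Set) (Φ : Alive n → ℕ) where

    1+-≤-/1 : ∀ {q} m n → q ≤ + m / 1 → m ℕ.< n → 1ℚ + q ≤ + n / 1
    1+-≤-/1 {q} m n q≤m m<n = begin
      1ℚ + q          ≤⟨ ℚ.+-monoʳ-≤ 1ℚ q≤m ⟩
      1ℚ + + m / 1    ≡⟨ suc-/1 m ⟨
      + suc m / 1     ≤⟨ /1-mono-≤ m<n ⟩
      + n / 1         ∎
      where open ℚ.≤-Reasoning

    -- Induction on the fuel: each possible choice adds one edge and lowers `Φ` by at least one, so
    -- every branch is at most `Φ a` and so is the mean. Running out of fuel or of edges yields 0,
    -- which is below any potential.
    expEDSM-≤ :
      (∀ a u v → Inv a → u ∈ argmins (deg G a) (nonIsolated G a) → v ∈ argmins (deg G a) (nbrs G a u) →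
        Inv (remove a u v) × Φ (remove a u v) ℕ.< Φ a) →
      ∀ k a → Inv a → expEDSM k G a ≤ + Φ a / 1
    expEDSM-≤ step ℕ.zero  a inv = 0≤/1 (Φ a)
    expEDSM-≤ step (suc k) a inv =
      mean-≤ _ (0≤/1 (Φ a)) (argmins (deg G a) (nonIsolated G a)) λ {u} u∈ →
      mean-≤ _ (0≤/1 (Φ a)) (argmins (deg G a) (nbrs G a u)) λ {v} v∈ →
      let inv′ , dec = step a u v inv u∈ v∈ in 1+-≤-/1 (Φ (remove a u v)) (Φ a) (expEDSM-≤ step k (remove a u v) inv′) dec

    expMDS-≤ :
      (∀ a u v → Inv a → (u , v) ∈ argmins (λ e → deg G a (proj₁ e) ℕ.+ deg G a (proj₂ e)) (edges G a) →
        Inv (remove a u v) × Φ (remove a u v) ℕ.< Φ a) →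
      ∀ k a → Inv a → expMDS k G a ≤ + Φ a / 1
    expMDS-≤ step ℕ.zero  a inv = 0≤/1 (Φ a)
    expMDS-≤ step (suc k) a inv =
      mean-≤ _ (0≤/1 (Φ a)) (argmins (λ e → deg G a (proj₁ e) ℕ.+ deg G a (proj₂ e)) (edges G a)) λ { {u , v} e∈ →
      let inv′ , dec = step a u v inv e∈ in 1+-≤-/1 (Φ (remove a u v)) (Φ a) (expMDS-≤ step k (remove a u v) inv′) dec }

-- Matchings and their endpoints.

map-endpoints-unique : ∀ {m n} (f : Fin m × Bool → Fin n) → (∀ {x y} → f x ≡ f y → x ≡ y) →
  ∀ {is} → Unique is → Unique (endpoints (map (λ i → f (i , false) , f (i , true)) is))
map-endpoints-unique {m} f f-inj = go
  where
  ends : Fin m → Fin _ × Fin _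
  ends i = f (i , false) , f (i , true)

  ∈-endpoints⁻ : ∀ {z} is → z ∈ endpoints (map ends is) → ∃ λ i → i ∈ is × ∃ λ b → z ≡ f (i , b)
  ∈-endpoints⁻ (i ∷ is) (here z≡)          = i , here refl , false , z≡
  ∈-endpoints⁻ (i ∷ is) (there (here z≡))  = i , here refl , true , z≡
  ∈-endpoints⁻ (i ∷ is) (there (there z∈)) =
    let j , j∈ , b , z≡ = ∈-endpoints⁻ is z∈ in j , there j∈ , b , z≡

  fresh : ∀ {i is} b → All (i ≢_) is → All (f (i , b) ≢_) (endpoints (map ends is))
  fresh {i} {is} b i≢ = All.tabulate λ z∈ fi≡z →
    let j , j∈ , c , z≡ = ∈-endpoints⁻ is z∈
    in All.lookup i≢ j∈ (cong proj₁ (f-inj (trans fi≡z z≡)))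

  go : ∀ {is} → Unique is → Unique (endpoints (map ends is))
  go []                  = []
  go (_∷_ {i} i≢ is!)    =
    ((λ eq → contradiction (cong proj₂ (f-inj eq)) λ ()) ∷ fresh false i≢) ∷ fresh true i≢ ∷ go is!

-- The endpoints are distinct vertices, two for each edge.
matching-length-≤ : ∀ {n} (G : Graph n) M → IsMatching G M → length M ℕ.* 2 ℕ.≤ n
matching-length-≤ {n} G M (_ , M!) = begin
  length M ℕ.* 2         ≡⟨ length-endpoints M ⟨
  length (endpoints M)   ≤⟨ unique-⊆⇒length-≤ M! (λ _ → ∈-allFin _) ⟩
  length (allFin n)      ≡⟨ length-allFin n ⟩
  n                      ∎
  where
  open ℕ.≤-Reasoning
  length-endpoints : ∀ (M : List (Fin n × Fin n)) → length (endpoints M) ≡ length M ℕ.* 2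
  length-endpoints []      = refl
  length-endpoints (_ ∷ M) = cong (2 ℕ.+_) (length-endpoints M)

-- The trap graph and its 2-coloring.

-- These index the edges of the perfect matching: `A s i` with `B s i`, and `X false j` with
-- `X true j`. The Boolean added in `Vertex` selects an end.
Pair : ℕ → Set
Pair n = (Bool × Fin n) ⊎ Fin 5

Vertex : ℕ → Set
Vertex n = Pair n × Bool

pattern A s i = inj₁ (s , i) , false
pattern B s i = inj₁ (s , i) , true
pattern X s j = inj₂ j , s

-- The gadget i is the path A false i – B false i – B true i – A true i, whose inner edge is the
-- trap; the hubs X s j raise the degrees of all A s i.
data _~_ {n} : Vertex n → Vertex n → Set where
  ab : ∀ {s i} → A s i ~ B s i
  ba : ∀ {s i} → B s i ~ A s i
  ax : ∀ {s i j} → A s i ~ X s j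
  xa : ∀ {s i j} → X s j ~ A s i
  bb : ∀ {s t i} → s ≢ t → B s i ~ B t i
  xx : ∀ {s t j} → s ≢ t → X s j ~ X t j

~-sym : ∀ {n} {x y : Vertex n} → x ~ y → y ~ x
~-sym ab       = ba
~-sym ba       = ab
~-sym ax       = xa
~-sym xa       = ax
~-sym (bb s≢t) = bb (≢-sym s≢t)
~-sym (xx s≢t) = xx (≢-sym s≢t)

_~?_ : ∀ {n} (x y : Vertex n) → Dec (x ~ y)
A s i ~? A t j = no λ ()
A s i ~? B t j = map′ (λ { (refl , refl) → ab }) (λ { ab → refl , refl }) (s Bool.≟ t ×-dec i Fin.≟ j)
A s i ~? X t j = map′ (λ { refl → ax }) (λ { ax → refl }) (s Bool.≟ t)
B s i ~? A t j = map′ (λ { (refl , refl) → ba }) (λ { ba → refl , refl }) (s Bool.≟ t ×-dec i Fin.≟ j)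
B s i ~? B t j = map′ (λ { (s≢t , refl) → bb s≢t }) (λ { (bb s≢t) → s≢t , refl }) (¬? (s Bool.≟ t) ×-dec i Fin.≟ j)
B s i ~? X t j = no λ ()
X s i ~? A t j = map′ (λ { refl → xa }) (λ { xa → refl }) (s Bool.≟ t)
X s i ~? B t j = no λ ()
X s i ~? X t j = map′ (λ { (s≢t , refl) → xx s≢t }) (λ { (xx s≢t) → s≢t , refl }) (¬? (s Bool.≟ t) ×-dec i Fin.≟ j)

color : ∀ {n} → Vertex n → Bool
color (A s i) = s
color (B s i) = not s
color (X s j) = not s

~⇒color-≢ : ∀ {n} {x y : Vertex n} → x ~ y → color x ≢ color y
~⇒color-≢ ab       = not-¬ refl
~⇒color-≢ ba       = ≢-sym (not-¬ refl)
~⇒color-≢ ax       = not-¬ refl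
~⇒color-≢ xa       = ≢-sym (not-¬ refl)
~⇒color-≢ (bb s≢t) = s≢t ∘ not-injective
~⇒color-≢ (xx s≢t) = s≢t ∘ not-injective

-- Every edge of the graph, except the A false i – B false i, has an endpoint satisfying this.
covering : ∀ {n} → Vertex n → Bool
covering (A s i) = false
covering (B s i) = s
covering (X s j) = true

⌊⌋-cong : ∀ {P Q : Set} (P? : Dec P) (Q? : Dec Q) → (P → Q) → (Q → P) → ⌊ P? ⌋ ≡ ⌊ Q? ⌋
⌊⌋-cong (yes _) (yes _)  _ _ = refl
⌊⌋-cong (yes p) (no ¬q)  f _ = contradiction (f p) ¬q
⌊⌋-cong (no ¬p) (yes q)  _ g = contradiction (g q) ¬p
⌊⌋-cong (no _)  (no _)   _ _ = refl

⌊⌋-false : ∀ {P : Set} (P? : Dec P) → ¬ P → ⌊ P? ⌋ ≡ false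
⌊⌋-false (yes p) ¬p = contradiction p ¬p
⌊⌋-false (no _)  _  = refl

-- Numbering the vertices, and the matching number.

module Construction (n : ℕ) where

  ν N : ℕ
  ν = 2 ℕ.* n ℕ.+ 5
  N = ν ℕ.* 2

  pairs : Fin ν ↔ Pair n
  pairs = ↔-trans Fin.+↔⊎ (↔-trans Fin.*↔× (Fin.2↔Bool ×-↔ ↔-refl) ⊎-↔ ↔-refl)

  halves : Fin N ↔ (Fin ν × Bool)
  halves = ↔-trans Fin.*↔× (↔-refl ×-↔ Fin.2↔Bool)

  -- Later proofs use only the inverse laws and `vertex-half`, so the arithmetic on `Fin` never
  -- unfolds. `vertex-half` records that the numbering respects the pairs, which is what the perfect
  -- matching needs.
  opaque
    vertices : Fin N ↔ Vertex n
    vertices = ↔-trans halves (pairs ×-↔ ↔-refl)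

    vertex-half : ∀ i b → Inverse.to vertices (Inverse.from halves (i , b)) ≡ (Inverse.to pairs i , b)
    vertex-half i b = cong (λ p → Inverse.to pairs (proj₁ p) , proj₂ p) (Inverse.strictlyInverseˡ halves (i , b))

  open Inverse vertices using () renaming (to to vertex; from to ⟦_⟧)

  vertex-⟦⟧ : ∀ x → vertex ⟦ x ⟧ ≡ x
  vertex-⟦⟧ = Inverse.strictlyInverseˡ vertices

  ⟦⟧-vertex : ∀ u → ⟦ vertex u ⟧ ≡ u
  ⟦⟧-vertex = Inverse.strictlyInverseʳ vertices

  ⟦⟧-injective : ∀ {x y} → ⟦ x ⟧ ≡ ⟦ y ⟧ → x ≡ y
  ⟦⟧-injective {x} {y} eq = trans (sym (vertex-⟦⟧ x)) (trans (cong vertex eq) (vertex-⟦⟧ y))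

  G : Graph N
  G = record
    { adj    = λ u v → ⌊ vertex u ~? vertex v ⌋
    ; sym    = λ u v → ⌊⌋-cong (vertex u ~? vertex v) (vertex v ~? vertex u) ~-sym ~-sym
    ; irrefl = λ u → ⌊⌋-false (vertex u ~? vertex u) λ u~u → ~⇒color-≢ u~u refl
    }

  adj⁺ : ∀ {x y} → x ~ y → T (adj G ⟦ x ⟧ ⟦ y ⟧)
  adj⁺ {x} {y} x~y = fromWitness (subst₂ _~_ (sym (vertex-⟦⟧ x)) (sym (vertex-⟦⟧ y)) x~y)

  adj⁻ : ∀ {u v} → T (adj G u v) → vertex u ~ vertex v
  adj⁻ = toWitness

  bipartite : Bipartite G
  bipartite = color ∘ vertex , λ u v uv → ~⇒color-≢ (adj⁻ uv)

  matchingNumber : IsMatchingNumber G ν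
  matchingNumber =
    (map pair (allFin ν)
      , (All.tabulate (λ e∈ → let i , _ , e≡ = ∈-map⁻ pair e∈ in subst (λ e → T (adj G (proj₁ e) (proj₂ e))) (sym e≡) (pair-adj i))
        , map-endpoints-unique half half-injective (Unique.allFin⁺ ν))
      , trans (length-map pair (allFin ν)) (length-allFin ν))
    -- There are `ν ℕ.* 2` vertices, so no matching exceeds a perfect one.
    , λ M M-matching → ℕ.*-cancelʳ-≤ (length M) ν 2 (matching-length-≤ G M M-matching)
    where
    half : Fin ν × Bool → Fin N
    half = Inverse.from halves

    half-injective : ∀ {x y} → half x ≡ half y → x ≡ y
    half-injective {x} {y} eq = trans (sym (Inverse.strictlyInverseˡ halves x))
      (trans (cong (Inverse.to halves) eq) (Inverse.strictlyInverseˡ halves y))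

    pair : Fin ν → Fin N × Fin N
    pair i = half (i , false) , half (i , true)

    pair~ : ∀ (e : Pair n) → (e , false) ~ (e , true)
    pair~ (inj₁ _) = ab
    pair~ (inj₂ _) = xx λ ()

    pair-adj : ∀ i → T (adj G (half (i , false)) (half (i , true)))
    pair-adj i = fromWitness (subst₂ _~_ (sym (vertex-half i false)) (sym (vertex-half i true)) (pair~ (Inverse.to pairs i)))

  edge⁺ : ∀ a {x y} → T (a ⟦ x ⟧) → T (a ⟦ y ⟧) → x ~ y → T (edgeIn G a ⟦ x ⟧ ⟦ y ⟧)
  edge⁺ a x∈a y∈a x~y = edgeIn⁺ G a x∈a y∈a (adj⁺ x~y)

  -- The potential and the invariant.

  Φ : Alive N → ℕ
  Φ = aliveIn (covering ∘ vertex)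

  Φ-remove : ∀ a u v x → ⟦ x ⟧ ≡ u ⊎ ⟦ x ⟧ ≡ v → T (covering x) → T (a ⟦ x ⟧) → Φ (remove a u v) ℕ.< Φ a
  Φ-remove a u v x x≡ cx x∈a = aliveIn-remove (covering ∘ vertex) a u v ⟦ x ⟧ x≡ x∈a
    (subst (T ∘ covering) (sym (vertex-⟦⟧ x)) cx)

  Φ-allAlive-≤ : Φ allAlive ℕ.≤ n ℕ.+ 10
  Φ-allAlive-≤ = begin
    Φ allAlive                        ≤⟨ unique-⊆⇒length-≤ (filterᵇ-unique _) (λ {u} u∈ → cover u (∈-filterᵇ⁻ _ u∈)) ⟩
    length (map b (allFin n) ++ hubs) ≡⟨ length-++ (map b (allFin n)) ⟩
    -- `length hubs` computes to 10: five hubs on each side.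
    length (map b (allFin n)) ℕ.+ 10  ≡⟨ cong (ℕ._+ 10) (trans (length-map b (allFin n)) (length-allFin n)) ⟩
    n ℕ.+ 10                          ∎
    where
    open ℕ.≤-Reasoning
    b : Fin n → Fin N
    b i = ⟦ B true i ⟧

    x : Bool → Fin 5 → Fin N
    x s j = ⟦ X s j ⟧

    hubs : List (Fin N)
    hubs = map (x false) (allFin 5) ++ map (x true) (allFin 5)

    ⟦⟧∈ : ∀ y → T (covering y) → ⟦ y ⟧ ∈ map b (allFin n) ++ hubs
    ⟦⟧∈ (B true i)  _ = ∈-++⁺ˡ (∈-map⁺ b (∈-allFin i))
    ⟦⟧∈ (X false j) _ = ∈-++⁺ʳ (map b (allFin n)) (∈-++⁺ˡ (∈-map⁺ (x false) (∈-allFin j)))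
    ⟦⟧∈ (X true j)  _ = ∈-++⁺ʳ (map b (allFin n)) (∈-++⁺ʳ (map (x false) (allFin 5)) (∈-map⁺ (x true) (∈-allFin j)))

    cover : ∀ u → T (covering (vertex u)) → u ∈ map b (allFin n) ++ hubs
    cover u cu = subst (_∈ map b (allFin n) ++ hubs) (⟦⟧-vertex u) (⟦⟧∈ (vertex u) cu)

  -- As long as some B is left, only edges between two Bs have been chosen.
  Inv : Alive N → Set
  Inv a = ∀ {s i} → T (a ⟦ B s i ⟧) →
    (∀ t → T (a ⟦ B t i ⟧)) × (∀ t k → T (a ⟦ A t k ⟧)) × (∀ t j → T (a ⟦ X t j ⟧))

  -- All that is used about either algorithm: while some `B` is alive, the chosen edge has degree
  -- sum at most 4, the bound attained by inner edges. Once no `B` is alive it demands nothing.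
  Light : Alive N → Fin N → Fin N → Set
  Light a u v = ∀ {s i} → T (a ⟦ B s i ⟧) → deg G a u ℕ.+ deg G a v ℕ.≤ 4

  -- Degrees while some `B` is alive.

  module _ {a : Alive N} where

    deg-B : ∀ s i → deg G a ⟦ B s i ⟧ ℕ.≤ 2
    deg-B s i = deg-≤ G a (⟦ A s i ⟧ ∷ ⟦ B (not s) i ⟧ ∷ []) λ {v} e →
      let _ , _ , uv = edgeIn⁻ G a e
      in subst (_∈ _) (⟦⟧-vertex v) (neighbor (subst (_~ vertex v) (vertex-⟦⟧ (B s i)) (adj⁻ uv)))
      where
      neighbor : ∀ {y} → B s i ~ y → ⟦ y ⟧ ∈ ⟦ A s i ⟧ ∷ ⟦ B (not s) i ⟧ ∷ []
      neighbor ba       = here refl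
      neighbor (bb s≢t) = there (here (cong (λ t → ⟦ B t i ⟧) (¬-not (≢-sym s≢t))))

    -- Bounds a degree from below by an injective family of alive neighbors: the five hubs for an
    -- `A`, the `n` vertices `A t k` for a hub.
    deg-family : ∀ {x m} (y : Fin m → Vertex n) → (∀ {i j} → y i ≡ y j → i ≡ j) →
      (∀ i → x ~ y i) → T (a ⟦ x ⟧) → (∀ i → T (a ⟦ y i ⟧)) → m ℕ.≤ deg G a ⟦ x ⟧
    deg-family {x} {m} y y-inj x~y x∈a ys∈a = subst (ℕ._≤ deg G a ⟦ x ⟧)
      (trans (length-map _ (allFin m)) (length-allFin m))
      (deg-≥ G a (map (λ i → ⟦ y i ⟧) (allFin m)) (Unique.map⁺ (y-inj ∘ ⟦⟧-injective) (Unique.allFin⁺ m))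
        λ v∈ → let i , _ , v≡ = ∈-map⁻ (λ i → ⟦ y i ⟧) v∈
               in subst (T ∘ edgeIn G a ⟦ x ⟧) (sym v≡) (edge⁺ a x∈a (ys∈a i) (x~y i)))

    module _ (inv : Inv a) {s i} (b : T (a ⟦ B s i ⟧)) where

      partner-edge : ∀ {t} → s ≢ t → T (edgeIn G a ⟦ B s i ⟧ ⟦ B t i ⟧)
      partner-edge {t} s≢t = edge⁺ a b (proj₁ (inv b) t) (bb s≢t)

      deg-A : ∀ t k → 5 ℕ.≤ deg G a ⟦ A t k ⟧
      deg-A t k = let _ , as , xs = inv b in
        deg-family (λ j → X t j) (λ { refl → refl }) (λ _ → ax) (as t k) (xs t)

      deg-X : 5 ℕ.≤ n → ∀ t j → 5 ℕ.≤ deg G a ⟦ X t j ⟧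
      deg-X 5≤n t j = let _ , as , xs = inv b in ℕ.≤-trans 5≤n
        (deg-family (λ k → A t k) (λ { refl → refl }) (λ _ → xa) (xs t j) (as t))

    -- Light edges preserve the invariant and lower the potential.

    module _ (5≤n : 5 ℕ.≤ n) (inv : Inv a) where

      -- While a `B` is alive, an end `A` or `X` alone has degree at least 5, so a light edge must
      -- join two `B`s. An edge at a hub is therefore chosen only when no `B` is left: then `Inv` is
      -- vacuous and the hub pays for the potential. An edge between an `A` and a `B` is never
      -- chosen. Named vertices `⟦ x ⟧` allow matching on `x ~ y`.
      light-step-⟦⟧ : ∀ {x y} → x ~ y → T (a ⟦ x ⟧) → T (a ⟦ y ⟧) → Light a ⟦ x ⟧ ⟦ y ⟧ →
        Inv (remove a ⟦ x ⟧ ⟦ y ⟧) × Φ (remove a ⟦ x ⟧ ⟦ y ⟧) ℕ.< Φ a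
      light-step-⟦⟧ {x} {y} x~y x∈a y∈a light = go x~y x∈a y∈a
        where
        heavy : 5 ℕ.≤ deg G a ⟦ x ⟧ ℕ.+ deg G a ⟦ y ⟧ → ∀ {s i} → ¬ T (a ⟦ B s i ⟧)
        heavy 5≤ b = ℕ.<⇒≱ 5≤ (light b)

        heavyˡ : (∀ {s i} → T (a ⟦ B s i ⟧) → 5 ℕ.≤ deg G a ⟦ x ⟧) → ∀ {s i} → ¬ T (a ⟦ B s i ⟧)
        heavyˡ 5≤ b = heavy (ℕ.≤-trans (5≤ b) (ℕ.m≤m+n _ _)) b

        heavyʳ : (∀ {s i} → T (a ⟦ B s i ⟧) → 5 ℕ.≤ deg G a ⟦ y ⟧) → ∀ {s i} → ¬ T (a ⟦ B s i ⟧)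
        heavyʳ 5≤ b = heavy (ℕ.≤-trans (5≤ b) (ℕ.m≤n+m _ _)) b

        exhausted : (∀ {s i} → ¬ T (a ⟦ B s i ⟧)) → Inv (remove a ⟦ x ⟧ ⟦ y ⟧)
        exhausted ¬b b = contradiction (proj₁ (remove⁻ a ⟦ x ⟧ ⟦ y ⟧ b)) ¬b

        go : x ~ y → T (a ⟦ x ⟧) → T (a ⟦ y ⟧) → Inv (remove a ⟦ x ⟧ ⟦ y ⟧) × Φ (remove a ⟦ x ⟧ ⟦ y ⟧) ℕ.< Φ a
        go (ab {s} {i}) _ b = contradiction b (heavyˡ (λ b → deg-A inv b s i))
        go (ba {s} {i}) b _ = contradiction b (heavyʳ (λ b → deg-A inv b s i))
        go (ax {s} {i}) _ h = exhausted (heavyˡ (λ b → deg-A inv b s i)) , Φ-remove a _ _ _ (inj₂ refl) _ h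
        go (xa {s} {i}) h _ = exhausted (heavyʳ (λ b → deg-A inv b s i)) , Φ-remove a _ _ _ (inj₁ refl) _ h
        go (xx {s} {j = j} _) h _ = exhausted (heavyˡ (λ b → deg-X inv b 5≤n s j)) , Φ-remove a _ _ _ (inj₁ refl) _ h
        go (bb {s} {t} {i} s≢t) b b′ = inv′ , Φ<
          where
          removed : ∀ r → B r i ≡ x ⊎ B r i ≡ y
          removed r with r Bool.≟ s
          ... | yes refl = inj₁ refl
          -- Two Booleans different from `s` are equal, so `r` is `t`.
          ... | no r≢s   = inj₂ (cong (λ q → B q i) (trans (¬-not r≢s) (sym (¬-not (≢-sym s≢t)))))

          inv′ : Inv (remove a ⟦ x ⟧ ⟦ y ⟧)
          inv′ {r} {k} c with c′ , c≢x , c≢y ← remove⁻ a ⟦ x ⟧ ⟦ y ⟧ c with bs , as , xs ← inv c′ =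
            (λ q → remove⁺ a _ _ (bs q) (k≢i ∘ B-index ∘ ⟦⟧-injective) (k≢i ∘ B-index ∘ ⟦⟧-injective))
            , (λ q l → remove⁺ a _ _ (as q l) (A≢B ∘ ⟦⟧-injective) (A≢B ∘ ⟦⟧-injective))
            , (λ q l → remove⁺ a _ _ (xs q l) (X≢B ∘ ⟦⟧-injective) (X≢B ∘ ⟦⟧-injective))
            where
            k≢i : k ≢ i
            -- Both `B`s of path `i` are deleted, so a surviving `B` lies on another path, whose two
            -- `B`s survive together.
            k≢i refl = [ c≢x ∘ cong ⟦_⟧ , c≢y ∘ cong ⟦_⟧ ] (removed r)
            B-index : ∀ {q q′ l m} → B q l ≡ B q′ m → l ≡ m
            B-index refl = refl
            A≢B : ∀ {q q′} {l m : Fin n} → _≢_ {A = Vertex n} (A q l) (B q′ m)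
            A≢B ()
            X≢B : ∀ {q q′ l} {m : Fin n} → _≢_ {A = Vertex n} (X q l) (B q′ m)
            X≢B ()

          Φ< : Φ (remove a ⟦ x ⟧ ⟦ y ⟧) ℕ.< Φ a
          Φ< with removed true
          ... | inj₁ eq = Φ-remove a _ _ (B true i) (inj₁ (cong ⟦_⟧ eq)) _ (proj₁ (inv b) true)
          ... | inj₂ eq = Φ-remove a _ _ (B true i) (inj₂ (cong ⟦_⟧ eq)) _ (proj₁ (inv b) true)

      light-step : ∀ {u v} → T (edgeIn G a u v) → Light a u v →
        Inv (remove a u v) × Φ (remove a u v) ℕ.< Φ a
      light-step {u} {v} e light with au , av , uv ← edgeIn⁻ G a e =
        subst₂ (λ u v → T (a u) → T (a v) → Light a u v → Inv (remove a u v) × Φ (remove a u v) ℕ.< Φ a)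
          (⟦⟧-vertex u) (⟦⟧-vertex v) (light-step-⟦⟧ (adj⁻ uv)) au av light

      -- Both algorithms choose light edges.

      -- An alive `B` is non-isolated of degree at most 2, so the minimum degree vertex `u` has
      -- degree at most 2 and is itself a `B`. Its partner is then an alive neighbor of degree at
      -- most 2, which bounds the degree of `v`.
      EDSM-light : ∀ {u v} → u ∈ argmins (deg G a) (nonIsolated G a) →
        v ∈ argmins (deg G a) (nbrs G a u) → Light a u v
      EDSM-light {u} {v} u∈ v∈ {s} {i} b = ℕ.+-mono-≤ deg-u≤2 deg-v≤2
        where
        u-min : ∀ {w} → w ∈ nonIsolated G a → deg G a u ℕ.≤ deg G a w
        u-min = proj₂ (∈-argmins⁻ (deg G a) (nonIsolated G a) u∈)

        v-min : ∀ {w} → w ∈ nbrs G a u → deg G a v ℕ.≤ deg G a w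
        v-min = proj₂ (∈-argmins⁻ (deg G a) (nbrs G a u) v∈)

        u-alive : T (a u)
        u-alive = proj₁ (edgeIn⁻ G a (∈-filterᵇ⁻ _ (proj₁ (∈-argmins⁻ (deg G a) (nbrs G a u) v∈))))

        deg-u≤2 : deg G a u ℕ.≤ 2
        deg-u≤2 = ℕ.≤-trans (u-min (∈-nonIsolated G a (partner-edge inv b (not-¬ refl)))) (deg-B s i)

        light-neighbor : ∀ x → deg G a ⟦ x ⟧ ℕ.≤ 2 → T (a ⟦ x ⟧) →
          ∃ λ w → T (edgeIn G a ⟦ x ⟧ w) × deg G a w ℕ.≤ 2
        light-neighbor (A t k) d≤2 _ = contradiction (ℕ.≤-trans (deg-A inv b t k) d≤2) λ { (ℕ.s≤s (ℕ.s≤s ())) }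
        light-neighbor (X t j) d≤2 _ = contradiction (ℕ.≤-trans (deg-X inv b 5≤n t j) d≤2) λ { (ℕ.s≤s (ℕ.s≤s ())) }
        light-neighbor (B t k) _   b′ = _ , partner-edge inv b′ (not-¬ refl) , deg-B (not t) k

        deg-v≤2 : deg G a v ℕ.≤ 2
        deg-v≤2 =
          let w , e , d≤2 = subst (λ u → deg G a u ℕ.≤ 2 → T (a u) → ∃ λ w → T (edgeIn G a u w) × deg G a w ℕ.≤ 2)
                              (⟦⟧-vertex u) (light-neighbor (vertex u)) deg-u≤2 u-alive
          in ℕ.≤-trans (v-min (∈-filterᵇ⁺ (edgeIn G a u) e)) d≤2

      -- The inner edge at an alive `B` competes with degree sum at most 4; the two cases are its
      -- possible orientations in `edges`.
      MDS-light : ∀ {u v} → (u , v) ∈ argmins (λ e → deg G a (proj₁ e) ℕ.+ deg G a (proj₂ e)) (edges G a) →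
        Light a u v
      MDS-light {u} {v} e∈ {s} {i} b with ∈-edges⁺ G a (partner-edge inv b (not-¬ refl))
      ... | inj₁ ∈E = ℕ.≤-trans (e-min ∈E) (ℕ.+-mono-≤ (deg-B s i) (deg-B (not s) i))
        where e-min = proj₂ (∈-argmins⁻ (λ e → deg G a (proj₁ e) ℕ.+ deg G a (proj₂ e)) (edges G a) e∈)
      ... | inj₂ ∈E = ℕ.≤-trans (e-min ∈E) (ℕ.+-mono-≤ (deg-B (not s) i) (deg-B s i))
        where e-min = proj₂ (∈-argmins⁻ (λ e → deg G a (proj₁ e) ℕ.+ deg G a (proj₂ e)) (edges G a) e∈)

  -- The bounds on the expected sizes.

  module _ (5≤n : 5 ℕ.≤ n) where

    E-EDSM-≤ : E-EDSM G ≤ + (n ℕ.+ 10) / 1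
    E-EDSM-≤ = ℚ.≤-trans
      (expEDSM-≤ G Inv Φ
        (λ a u v inv u∈ v∈ → light-step {a} 5≤n inv {u} {v}
          (∈-filterᵇ⁻ (edgeIn G a u) (proj₁ (∈-argmins⁻ (deg G a) (nbrs G a u) v∈)))
          (EDSM-light {a} 5≤n inv {u} {v} u∈ v∈))
        -- Initially every vertex is alive, so `Inv allAlive` is trivial.
        N allAlive _)
      (/1-mono-≤ Φ-allAlive-≤)

    E-MDS-≤ : E-MDS G ≤ + (n ℕ.+ 10) / 1
    E-MDS-≤ = ℚ.≤-trans
      (expMDS-≤ G Inv Φ
        (λ a u v inv e∈ → light-step {a} 5≤n inv {u} {v}
          (∈-edges⁻ G a (proj₁ (∈-argmins⁻ (λ e → deg G a (proj₁ e) ℕ.+ deg G a (proj₂ e)) (edges G a) e∈)))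
          (MDS-light {a} 5≤n inv {u} {v} e∈))
        N allAlive _)
      (/1-mono-≤ Φ-allAlive-≤)

-- Choosing the number of paths for a given ε.

-- Since ε is at least `1 / suc d`, taking `n = 5 ℕ.* suc d` makes 2nε at least 10. With n + 5/2
-- from the half, the right side exceeds n + 10.
/1-<-½+ε : ∀ p d .(c : Coprime (suc p) (suc d)) → let n = 5 ℕ.* suc d in
  + (n ℕ.+ 10) / 1 < (½ + mkℚ (+ suc p) d c) * (+ (2 ℕ.* n ℕ.+ 5) / 1)
/1-<-½+ε p d c = ℚ.toℚᵘ-cancel-< (begin-strict
  toℚᵘ (+ (n ℕ.+ 10) / 1)                                ≃⟨ toℚᵘ-/1 (n ℕ.+ 10) ⟩
  ℚᵘ.mkℚᵘ (+ (n ℕ.+ 10)) 0                               <⟨ ℚᵘ.*<* cross ⟩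
  (ℚᵘ.½ ℚᵘ.+ toℚᵘ ε) ℚᵘ.* ℚᵘ.mkℚᵘ (+ (2 ℕ.* n ℕ.+ 5)) 0  ≃⟨ ℚᵘ.*-cong (ℚ.toℚᵘ-homo-+ ½ ε) (toℚᵘ-/1 (2 ℕ.* n ℕ.+ 5)) ⟨
  toℚᵘ (½ + ε) ℚᵘ.* toℚᵘ (+ (2 ℕ.* n ℕ.+ 5) / 1)         ≃⟨ ℚ.toℚᵘ-homo-* (½ + ε) (+ (2 ℕ.* n ℕ.+ 5) / 1) ⟨
  toℚᵘ ((½ + ε) * (+ (2 ℕ.* n ℕ.+ 5) / 1))               ∎)
  where
  open ℚᵘ.≤-Reasoning
  ε = mkℚ (+ suc p) d c
  n = 5 ℕ.* suc d

  -- The cross-multiplied inequality with its explicit surplus; the factors 1 mirror the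
  -- unnormalised numerators and denominators.
  slack : ∀ p d → (1 ℕ.* suc d ℕ.+ suc p ℕ.* 2) ℕ.* (2 ℕ.* (5 ℕ.* suc d) ℕ.+ 5) ℕ.* 1
    ≡ suc ((5 ℕ.* suc d ℕ.+ 10) ℕ.* (2 ℕ.* suc d ℕ.* 1) ℕ.+ (5 ℕ.* d ℕ.+ 14 ℕ.+ p ℕ.* 2 ℕ.* (10 ℕ.* d ℕ.+ 15)))
  slack = solve-∀

  cross : + (n ℕ.+ 10) ℤ.* + (2 ℕ.* suc d ℕ.* 1)
    ℤ.< ((+ 1 ℤ.* + suc d ℤ.+ + suc p ℤ.* + 2) ℤ.* + (2 ℕ.* n ℕ.+ 5)) ℤ.* + 1
  cross = subst₂ ℤ._<_ (ℤ.pos-* (n ℕ.+ 10) (2 ℕ.* suc d ℕ.* 1)) rhs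
    (ℤ.+<+ (subst ((n ℕ.+ 10) ℕ.* (2 ℕ.* suc d ℕ.* 1) ℕ.<_) (sym (slack p d)) (ℕ.s≤s (ℕ.m≤m+n _ _))))
    where
    rhs : + ((1 ℕ.* suc d ℕ.+ suc p ℕ.* 2) ℕ.* (2 ℕ.* n ℕ.+ 5) ℕ.* 1)
      ≡ ((+ 1 ℤ.* + suc d ℤ.+ + suc p ℤ.* + 2) ℤ.* + (2 ℕ.* n ℕ.+ 5)) ℤ.* + 1
    rhs = trans (ℤ.pos-* ((1 ℕ.* suc d ℕ.+ suc p ℕ.* 2) ℕ.* (2 ℕ.* n ℕ.+ 5)) 1)
      (cong (ℤ._* + 1) (ℤ.pos-* (1 ℕ.* suc d ℕ.+ suc p ℕ.* 2) (2 ℕ.* n ℕ.+ 5)))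

theorem2 : (ε : ℚ) → 0ℚ < ε →
    Σ ℕ λ n → Σ (Graph n) λ G → Bipartite G × Σ ℕ λ ν → IsMatchingNumber G ν ×
    (E-EDSM G < (½ + ε) * (+ ν / 1)) × (E-MDS G < (½ + ε) * (+ ν / 1))
theorem2 (mkℚ (+ suc p) d c) 0<ε =
  N , G , bipartite , ν , matchingNumber
  , ℚ.≤-<-trans (E-EDSM-≤ 5≤n) (/1-<-½+ε p d c)
  , ℚ.≤-<-trans (E-MDS-≤ 5≤n) (/1-<-½+ε p d c)
  where
  open Construction (5 ℕ.* suc d)
  5≤n : 5 ℕ.≤ 5 ℕ.* suc d
  5≤n = ℕ.m≤m*n 5 (suc d)
theorem2 (mkℚ (+ 0) d c) 0<ε = contradiction (positive 0<ε) λ ()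
theorem2 (mkℚ ℤ.-[1+ p ] d c) 0<ε = contradiction (positive 0<ε) λ ()
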